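{- Let $m,n$ be positive integers and let $R=(r_1,\dots,r_m)$, $S=(s_1,\dots,s_n)$ be nonnegative integral vectors with $\sum_i r_i=\sum_j s_j$. The map $f$ sending a matrix $A\in\mathcal{C}_{m,n}(R,S)$ to its ranked essential set is injective. Moreover, there is an algorithm which, given $R$, $S$ and the ranked essential set $f(A)$ of some $A\in\mathcal{C}_{m,n}(R,S)$, reconstructs $A$ in $O(mn)$ time.
   Context: A $(0,1)$-matrix is convex if in every row and every column the 1's occur in consecutive positions. $\mathcal{C}_{m,n}(R,S)$ denotes the set of convex $m\times n$ $(0,1)$-matrices with row sum vector $R$ and column sum vector $S$. The diagram of an $m\times n$ $(0,1)$-matrix $A$ is obtained as follows: for each 1 of $A$, in position $(i,j)$ say, shade all positions $(i,j')$ with $j'\ge j$ and all positions $(i',j)$ with $i'\ge i$; the diagram is the set of unshaded positions. The essential set of $A$ is the set of southeast corners of the (rookwise-connected) components of the diagram, i.e. the positions $(i,j)$ of the diagram such that neither $(i+1,j)$ nor $(i,j+1)$ belongs to the diagram. The ranked essential set of $A$ is the set of triples $(i,j;r)$ with $(i,j)$ in the essential set and $r$ the number of 1's of $A$ in the submatrix formed by rows $1,\dots,i$ and columns $1,\dots,j$. -}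

module Defs where

open import Level using (0ℓ)
open import Data.Bool.Base using (if_then_else_)
open import Data.Nat.Base as ℕ using (ℕ; zero; suc; _+_; _*_; _∸_; _≡ᵇ_)
open import Data.Nat.Properties using (+-0-commutativeMonoid)
open import Data.Fin.Base as Fin using (Fin; toℕ; inject≤)
open import Data.Fin.Patterns using (1F)
open import Data.Fin.Properties using (toℕ<n)
open import Data.List.Base using (List; []; _∷_; length; map)
open import Data.List.Membership.Propositional using (_∈_)
open import Data.List.Relation.Unary.Unique.Propositional using (Unique)
open import Data.Product.Base using (_×_; _,_; proj₁; proj₂; ∃₂)
open import Data.Sum.Base using (_⊎_)
open import Data.Vec.Functional using (Vector; toList)
open import Function.Bundles using (_⇔_)
open import Relation.Binary.PropositionalEquality using (_≡_)
open import Relation.Nullary using (¬_)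
open import Relation.Unary using (Pred)
open import Algebra.Properties.CommutativeMonoid.Sum +-0-commutativeMonoid public using (sum)

------------------------------------------------------------------------
-- Convex (0,1)-matrices

-- Rows and columns are numbered from 0, row 0 at the top (north) and
-- column 0 at the left (west).
Matrix01 : ℕ → ℕ → Set
Matrix01 m n = Fin m → Fin n → Fin 2

module _ {m n : ℕ} where

  record Convex (A : Matrix01 m n) : Set where
    field
      rows : ∀ i {j k l} → j Fin.< k → k Fin.< l →
             A i j ≡ 1F → A i l ≡ 1F → A i k ≡ 1F
      cols : ∀ j {i k l} → i Fin.< k → k Fin.< l →
             A i j ≡ 1F → A l j ≡ 1F → A k j ≡ 1F

  rowSum : Matrix01 m n → Vector ℕ m
  rowSum A i = sum (λ j → toℕ (A i j))

  colSum : Matrix01 m n → Vector ℕ n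
  colSum A j = sum (λ i → toℕ (A i j))

  record 𝒞 (R : Vector ℕ m) (S : Vector ℕ n) : Set where
    field
      matrix  : Matrix01 m n
      convex  : Convex matrix
      rowSums : ∀ i → rowSum matrix i ≡ R i
      colSums : ∀ j → colSum matrix j ≡ S j

  open 𝒞 public

  infix 4 _≈_

  _≈_ : {R : Vector ℕ m} {S : Vector ℕ n} → 𝒞 R S → 𝒞 R S → Set
  A ≈ B = ∀ i j → matrix A i j ≡ matrix B i j

------------------------------------------------------------------------
-- The ranked essential set

  Shaded : Matrix01 m n → Fin m → Fin n → Set
  Shaded A i j = ∃₂ λ a b → A a b ≡ 1F × ((i ≡ a × b Fin.≤ j) ⊎ (j ≡ b × a Fin.≤ i))

  Diagram : Matrix01 m n → Fin m → Fin n → Set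
  Diagram A i j = ¬ Shaded A i j

  -- A neighbour lying outside the m × n array is not in the diagram.
  record Essential (A : Matrix01 m n) (i : Fin m) (j : Fin n) : Set where
    field
      inDiagram : Diagram A i j
      south     : ∀ i′ → toℕ i′ ≡ suc (toℕ i) → ¬ Diagram A i′ j
      east      : ∀ j′ → toℕ j′ ≡ suc (toℕ j) → ¬ Diagram A i j′

  -- The number of 1's in rows 0,…,i and columns 0,…,j.
  rank : Matrix01 m n → Fin m → Fin n → ℕ
  rank A i j =
    sum {suc (toℕ i)} λ a → sum {suc (toℕ j)} λ b →
      toℕ (A (inject≤ a (toℕ<n i)) (inject≤ b (toℕ<n j)))

Triple : ℕ → ℕ → Set
Triple m n = Fin m × Fin n × ℕ

module _ {m n : ℕ} where

  RankedEssential : Matrix01 m n → Pred (Triple m n) 0ℓ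
  RankedEssential A (i , j , r) = Essential A i j × r ≡ rank A i j

  f : {R : Vector ℕ m} {S : Vector ℕ n} → 𝒞 R S → Pred (Triple m n) 0ℓ
  f A = RankedEssential (matrix A)

  -- L lists the elements of the set P in some order, without repetition.
  Enumerates : List (Triple m n) → Pred (Triple m n) 0ℓ → Set
  Enumerates L P = Unique L × (∀ t → t ∈ L ⇔ P t)

------------------------------------------------------------------------
-- Algorithms: structured programs for a uniform-cost random access
-- machine over ℕ, with addition and truncated subtraction as the only
-- arithmetic.  Memory consists of scalar variables and arrays, both
-- named by natural numbers; a program mentions only finitely many of
-- them.

infixl 6 _⊕_ _⊖_

data Expr : Set where
  num     : ℕ → Expr
  var     : ℕ → Expr
  arr     : ℕ → Expr → Expr
  _⊕_ _⊖_ : Expr → Expr → Expr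

data Prog : Set where
  skip   : Prog
  assign : (x : ℕ) (e : Expr) → Prog
  store  : (a : ℕ) (index value : Expr) → Prog
  seq    : Prog → Prog → Prog
  ifnz   : (test : Expr) (then else : Prog) → Prog
  while  : (test : Expr) (body : Prog) → Prog

record State : Set where
  constructor state
  field
    scalar : ℕ → ℕ
    array  : ℕ → ℕ → ℕ

open State public

update : {B : Set} → (ℕ → B) → ℕ → B → ℕ → B
update g x v y = if x ≡ᵇ y then v else g y

setScalar : State → ℕ → ℕ → State
setScalar s x v = state (update (scalar s) x v) (array s)

setArray : State → ℕ → ℕ → ℕ → State
setArray s a k v = state (scalar s) (update (array s) a (update (array s a) k v))

eval : State → Expr → ℕ
eval s (num k)   = k
eval s (var x)   = scalar s x
eval s (arr a e) = array s a (eval s e)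
eval s (d ⊕ e)   = eval s d + eval s e
eval s (d ⊖ e)   = eval s d ∸ eval s e

-- Each node of an expression costs one step.
cost : Expr → ℕ
cost (num k)   = 1
cost (var x)   = 1
cost (arr a e) = 1 + cost e
cost (d ⊕ e)   = 1 + (cost d + cost e)
cost (d ⊖ e)   = 1 + (cost d + cost e)

-- ⟨ p , s ⟩⇓⟨ s′ , t ⟩: started in state s, the program p halts in
-- state s′ after t steps.  A test succeeds when its value is nonzero.
infix 4 ⟨_,_⟩⇓⟨_,_⟩

data ⟨_,_⟩⇓⟨_,_⟩ : Prog → State → State → ℕ → Set where

  skip : ∀ {s} → ⟨ skip , s ⟩⇓⟨ s , 1 ⟩

  assign : ∀ {s x e} →
    ⟨ assign x e , s ⟩⇓⟨ setScalar s x (eval s e) , 1 + cost e ⟩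

  store : ∀ {s a d e} →
    ⟨ store a d e , s ⟩⇓⟨ setArray s a (eval s d) (eval s e) , 1 + (cost d + cost e) ⟩

  seq : ∀ {s s′ s″ p q t u} →
    ⟨ p , s ⟩⇓⟨ s′ , t ⟩ → ⟨ q , s′ ⟩⇓⟨ s″ , u ⟩ →
    ⟨ seq p q , s ⟩⇓⟨ s″ , t + u ⟩

  ifTrue : ∀ {s s′ e p q t} →
    ¬ (eval s e ≡ 0) → ⟨ p , s ⟩⇓⟨ s′ , t ⟩ →
    ⟨ ifnz e p q , s ⟩⇓⟨ s′ , 1 + cost e + t ⟩

  ifFalse : ∀ {s s′ e p q t} →
    eval s e ≡ 0 → ⟨ q , s ⟩⇓⟨ s′ , t ⟩ →
    ⟨ ifnz e p q , s ⟩⇓⟨ s′ , 1 + cost e + t ⟩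

  whileTrue : ∀ {s s′ s″ e p t u} →
    ¬ (eval s e ≡ 0) → ⟨ p , s ⟩⇓⟨ s′ , t ⟩ → ⟨ while e p , s′ ⟩⇓⟨ s″ , u ⟩ →
    ⟨ while e p , s ⟩⇓⟨ s″ , 1 + cost e + (t + u) ⟩

  whileFalse : ∀ {s e p} →
    eval s e ≡ 0 → ⟨ while e p , s ⟩⇓⟨ s , 1 + cost e ⟩

------------------------------------------------------------------------
-- Input and output conventions

cells : List ℕ → ℕ → ℕ
cells []       _       = 0
cells (x ∷ xs) zero    = x
cells (x ∷ xs) (suc k) = cells xs k

-- Scalars 0, 1, 2 hold m, n and the number of triples; arrays 0 and 1
-- hold R and S; arrays 2, 3, 4 hold the components i, j, r of the
-- successive triples.  All other memory is initially 0.
input : ∀ {m n} → Vector ℕ m → Vector ℕ n → List (Triple m n) → State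
input {m} {n} R S L = state scalars arrays
  where
  scalars : ℕ → ℕ
  scalars 0 = m
  scalars 1 = n
  scalars 2 = length L
  scalars _ = 0

  arrays : ℕ → ℕ → ℕ
  arrays 0 = cells (toList R)
  arrays 1 = cells (toList S)
  arrays 2 = cells (map (λ t → toℕ (proj₁ t)) L)
  arrays 3 = cells (map (λ t → toℕ (proj₁ (proj₂ t))) L)
  arrays 4 = cells (map (λ t → proj₂ (proj₂ t)) L)
  arrays _ = λ _ → 0

-- The output matrix is read off array 5, in row-major order.
Outputs : ∀ {m n} → State → Matrix01 m n → Set
Outputs {n = n} s A = ∀ i j → array s 5 (toℕ i * n + toℕ j) ≡ toℕ (A i j)

-- p computes A from R, S and f(A) in at most c·m·n steps, whatever the
-- order in which the elements of f(A) are listed.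
Reconstructs : Prog → ℕ → ∀ {m n} {R : Vector ℕ m} {S : Vector ℕ n} → 𝒞 R S → Set
Reconstructs p c {m} {n} {R} {S} A =
  ∀ L → Enumerates L (f A) →
  ∃₂ λ s t → ⟨ p , input R S L ⟩⇓⟨ s , t ⟩ × t ℕ.≤ c * (m * n) × Outputs s (matrix A)

{-# OPTIONS --safe #-}
module Submission where

-- Suppose the rows above row i are known, and call a column unstarted if it
-- has no 1 there and exhausted if all of its 1's are there.  By convexity a
-- column having a 0 in row i is unstarted or exhausted.  Let M be the least
-- column such that no column j ≥ M has a next essential position (i′, j),
-- i′ ≥ i, whose rank equals the number of 1's above row i in columns 0,…,j.
-- Then the 1's of row i begin at the first nonexhausted column from M on:
-- equality of the two ranks forces zeros in columns 0,…,j of row i, and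
-- conversely, left of the first 1 of row i, the last column j of each run of
-- unstarted columns satisfies it, because descending from (i, j) within the
-- diagram ends at an essential position.  Tabulating the next essential
-- position below each cell makes this an O(mn) algorithm, and
-- injectivity follows since the algorithm sees only R, S and f(A).

open import Defs
open import Data.Bool.Base using (true; false; T)
open import Data.Empty using (⊥-elim)
open import Data.Fin.Base as Fin using (Fin; toℕ; fromℕ<; combine) renaming (zero to fzero; suc to fsuc)
open import Data.Fin.Patterns using (0F; 1F)
open import Data.Fin.Properties using (toℕ<n; toℕ-injective; toℕ-fromℕ<; toℕ-inject≤; combine-injective; injective⇒≤; all?)
open import Data.List.Base as List using (List; []; _∷_; length; lookup; filter; allFin; cartesianProduct)
open import Data.List.Membership.Propositional using (_∈_)
open import Data.List.Membership.Propositional.Properties using (∈-lookup; ∈-allFin; ∈-cartesianProduct⁺; ∈-map∘filter⁺; ∈-map∘filter⁻)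
import Data.List.Relation.Unary.All as All
open import Relation.Binary.Definitions using (tri<; tri≈; tri>)
open import Data.List.Relation.Unary.AllPairs using (_∷_)
open import Data.List.Relation.Unary.Any using (index)
open import Data.List.Relation.Unary.Any.Properties using (lookup-index)
open import Data.List.Relation.Unary.Unique.Propositional using (Unique)
open import Data.List.Relation.Unary.Unique.Propositional.Properties using (map⁺; filter⁺; cartesianProduct⁺; allFin⁺)
open import Data.Nat.Base
open import Data.Nat.Properties
open import Data.Product.Base using (_×_; _,_; proj₁; proj₂; ∃; ∃₂)
open import Data.Sum.Base using (_⊎_; inj₁; inj₂)
open import Data.Vec.Functional using (Vector; toList)
open import Function.Base using (_∘_; case_of_; id)
open import Function.Bundles using (mk⇔; Equivalence)
open import Function.Definitions using (Injective)
open import Relation.Binary.PropositionalEquality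
open import Relation.Nullary using (¬_; Dec; yes; no; contradiction)
open import Relation.Nullary.Decidable using (map′; ¬?; _×-dec_; _→-dec_)
open import Relation.Unary using (_≐_)

-- Sums over initial segments of ℕ

∑< : ℕ → (ℕ → ℕ) → ℕ
∑< zero    g = 0
∑< (suc k) g = ∑< k g + g k

∑<-cong : ∀ k {g h : ℕ → ℕ} → (∀ {b} → b < k → g b ≡ h b) → ∑< k g ≡ ∑< k h
∑<-cong zero    g≗h = refl
∑<-cong (suc k) g≗h = cong₂ _+_ (∑<-cong k (g≗h ∘ m<n⇒m<1+n)) (g≗h ≤-refl)

∑<-front : ∀ k g → ∑< (suc k) g ≡ g 0 + ∑< k (g ∘ suc)
∑<-front zero    g = sym (+-identityʳ (g 0))
∑<-front (suc k) g = begin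
  ∑< (suc k) g + g (suc k)             ≡⟨ cong (_+ g (suc k)) (∑<-front k g) ⟩
  g 0 + ∑< k (g ∘ suc) + g (suc k)     ≡⟨ +-assoc (g 0) _ _ ⟩
  g 0 + (∑< k (g ∘ suc) + g (suc k))   ∎
  where open ≡-Reasoning

∑<-+ : ∀ k g h → ∑< k (λ b → g b + h b) ≡ ∑< k g + ∑< k h
∑<-+ zero    g h = refl
∑<-+ (suc k) g h = begin
  ∑< k (λ b → g b + h b) + (g k + h k)   ≡⟨ cong (_+ (g k + h k)) (∑<-+ k g h) ⟩
  ∑< k g + ∑< k h + (g k + h k)          ≡⟨ +-assoc (∑< k g) _ _ ⟩
  ∑< k g + (∑< k h + (g k + h k))        ≡⟨ cong (∑< k g +_) (sym (+-assoc (∑< k h) (g k) (h k))) ⟩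
  ∑< k g + (∑< k h + g k + h k)          ≡⟨ cong (λ z → ∑< k g + (z + h k)) (+-comm (∑< k h) (g k)) ⟩
  ∑< k g + (g k + ∑< k h + h k)          ≡⟨ cong (∑< k g +_) (+-assoc (g k) _ _) ⟩
  ∑< k g + (g k + (∑< k h + h k))        ≡⟨ sym (+-assoc (∑< k g) (g k) _) ⟩
  ∑< k g + g k + (∑< k h + h k)          ∎
  where open ≡-Reasoning

∑<-zero : ∀ k → ∑< k (λ _ → 0) ≡ 0
∑<-zero zero    = refl
∑<-zero (suc k) = trans (+-identityʳ _) (∑<-zero k)

∑<-monoˡ : ∀ {k l} g → k ≤ l → ∑< k g ≤ ∑< l g
∑<-monoˡ {k} g k≤l = subst (λ z → ∑< k g ≤ ∑< z g) (m∸n+n≡m k≤l) (go (_ ∸ k))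
  where
  go : ∀ d → ∑< k g ≤ ∑< (d + k) g
  go zero    = ≤-refl
  go (suc d) = ≤-trans (go d) (m≤m+n _ _)

∑<-bound : ∀ {k b} g → b < k → g b ≤ ∑< k g
∑<-bound {b = b} g b<k = ≤-trans (m≤n+m (g b) (∑< b g)) (∑<-monoˡ g b<k)

∑<≡0⁻ : ∀ {k b} {g : ℕ → ℕ} → ∑< k g ≡ 0 → b < k → g b ≡ 0
∑<≡0⁻ {g = g} eq b<k = n≤0⇒n≡0 (subst (g _ ≤_) eq (∑<-bound g b<k))

∑<≡0⁺ : ∀ {k} {g : ℕ → ℕ} → (∀ {b} → b < k → g b ≡ 0) → ∑< k g ≡ 0
∑<≡0⁺ {k} zeros = trans (∑<-cong k zeros) (∑<-zero k)

∑<-increase : ∀ k l g → ∑< k g < ∑< l g → ∃ λ b → k ≤ b × b < l × g b ≢ 0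
∑<-increase k zero    g ()
∑<-increase k (suc l) g lt with g l ≟ 0
... | no gl≢0 = l , ≮⇒≥ (λ l<k → <⇒≱ lt (∑<-monoˡ g l<k)) , ≤-refl , gl≢0
... | yes gl≡0 with b , k≤b , b<l , gb≢0 ← ∑<-increase k l g (subst (∑< k g <_) (trans (cong (∑< l g +_) gl≡0) (+-identityʳ _)) lt)
    = b , k≤b , m<n⇒m<1+n b<l , gb≢0

∑<-least : ∀ {k} g → ∑< k g ≢ 0 → ∃ λ b → b < k × g b ≢ 0 × ∑< b g ≡ 0
∑<-least {zero}  g ne = contradiction refl ne
∑<-least {suc k} g ne with ∑< k g ≟ 0
... | yes eq = k , ≤-refl , (λ gk≡0 → ne (cong₂ _+_ eq gk≡0)) , eq
... | no ne′ with b , b<k , rest ← ∑<-least {k} g ne′ = b , m<n⇒m<1+n b<k , rest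

sum-∑< : ∀ k {v : Vector ℕ k} {g} → (∀ i → v i ≡ g (toℕ i)) → sum v ≡ ∑< k g
sum-∑< zero    v≗g = refl
sum-∑< (suc k) {g = g} v≗g =
  trans (cong₂ _+_ (v≗g fzero) (sum-∑< k {g = g ∘ suc} (v≗g ∘ fsuc))) (sym (∑<-front k g))

-- Row-major positions

position-unique : ∀ {n} i i′ {j j′} → j < n → j′ < n → i * n + j ≡ i′ * n + j′ → i ≡ i′ × j ≡ j′
position-unique zero zero _ _ eq = refl , eq
position-unique {n} zero (suc i′) {j} {j′} j<n _ eq =
  contradiction (≤-trans (≤-trans (m≤m+n n (i′ * n)) (m≤m+n _ j′)) (≤-reflexive (sym eq))) (<⇒≱ j<n)
position-unique {n} (suc i) zero {j} {j′} _ j′<n eq =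
  contradiction (≤-trans (≤-trans (m≤m+n n (i * n)) (m≤m+n _ j)) (≤-reflexive eq)) (<⇒≱ j′<n)
position-unique {n} (suc i) (suc i′) {j} {j′} j<n j′<n eq
  with refl , refl ← position-unique i i′ j<n j′<n
         (+-cancelˡ-≡ n _ _ (trans (sym (+-assoc n (i * n) j)) (trans eq (+-assoc n (i′ * n) j′))))
  = refl , refl

position-bound : ∀ {m n i j} → i < m → j < n → i * n + j < m * n
position-bound {m} {n} {i} {j} i<m j<n = begin-strict
  i * n + j   <⟨ +-monoʳ-< (i * n) j<n ⟩
  i * n + n   ≡⟨ +-comm (i * n) n ⟩
  suc i * n   ≤⟨ *-monoˡ-≤ n i<m ⟩
  m * n       ∎
  where open ≤-Reasoning

-- Choice by a zero test

select : ℕ → ℕ → ℕ → ℕ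
select zero    x y = y
select (suc _) x y = x

select-≢0 : ∀ {k x y} → k ≢ 0 → select k x y ≡ x
select-≢0 {zero}  k≢0 = contradiction refl k≢0
select-≢0 {suc k} k≢0 = refl

select-≡0 : ∀ {k x y} → k ≡ 0 → select k x y ≡ y
select-≡0 refl = refl

select-same : ∀ k {x} → select k x x ≡ x
select-same zero    = refl
select-same (suc k) = refl

-- An equality test for a machine that has only truncated subtraction and zero tests: one of the two
-- differences is always 0, and both are 0 exactly at equality.
distance : ℕ → ℕ → ℕ
distance x y = (x ∸ y) + (y ∸ x)

distance≡0⇒≡ : ∀ {x y} → distance x y ≡ 0 → x ≡ y
distance≡0⇒≡ {x} {y} eq = ≤-antisym (m∸n≡0⇒m≤n (m+n≡0⇒m≡0 (x ∸ y) eq)) (m∸n≡0⇒m≤n (m+n≡0⇒n≡0 (x ∸ y) eq))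

distance-refl : ∀ {x y} → x ≡ y → distance x y ≡ 0
distance-refl {x} refl = cong₂ _+_ (n∸n≡0 x) (n∸n≡0 x)

-- Convex arrays over ℕ, and what the table of next ranks tells about a row.

record ConvexArray (m n : ℕ) : Set where
  field
    a         : ℕ → ℕ → ℕ
    r σ       : ℕ → ℕ
    a≤1       : ∀ {i j} → i < m → j < n → a i j ≤ 1
    rowConvex : ∀ {i j k l} → i < m → l < n → j < k → k < l → a i j ≢ 0 → a i l ≢ 0 → a i k ≢ 0
    colConvex : ∀ {i j k l} → j < n → l < m → i < k → k < l → a i j ≢ 0 → a l j ≢ 0 → a k j ≢ 0
    rowTotal  : ∀ {i} → i < m → ∑< n (a i) ≡ r i
    colTotal  : ∀ {j} → j < n → ∑< m (λ i → a i j) ≡ σ j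

module Array {m n : ℕ} (X : ConvexArray m n) where
  open ConvexArray X

  count : ℕ → ℕ → ℕ
  count i j = ∑< i (λ c → a c j)

  -- The number of 1's strictly above row i and strictly left of column j.
  rk : ℕ → ℕ → ℕ
  rk i j = ∑< i (λ c → ∑< j (a c))

  -- A position is unshaded when no 1 stands weakly west of it in its row or weakly north of it in
  -- its column. Vanishing sums make this decidable.
  InDiagram : ℕ → ℕ → Set
  InDiagram i j = ∑< (suc j) (a i) ≡ 0 × count (suc i) j ≡ 0

  inDiagram? : ∀ i j → Dec (InDiagram i j)
  inDiagram? i j = (∑< (suc j) (a i) ≟ 0) ×-dec (count (suc i) j ≟ 0)

  InEssential : ℕ → ℕ → Set
  InEssential i j = InDiagram i j × (suc i < m → ¬ InDiagram (suc i) j) × (suc j < n → ¬ InDiagram i (suc j))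

  rk-sucʳ : ∀ i j → rk i (suc j) ≡ rk i j + count i j
  rk-sucʳ i j = ∑<-+ i (λ c → ∑< j (a c)) (λ c → a c j)

  -- Ranks are stored shifted by one, zero meaning that there is no triple.
  record IsRankTable (t : ℕ → ℕ) : Set where
    field
      sound    : ∀ {i j q} → i < m → j < n → t (i * n + j) ≡ suc q → q ≡ rk (suc i) (suc j)
      complete : ∀ {i j} → i < m → j < n → InEssential i j → t (i * n + j) ≡ suc (rk (suc i) (suc j))
      outside  : ∀ {x} → m * n ≤ x → t x ≡ 0

  -- u holds, at each position, the first nonzero value of t at or below it
  -- in its column.
  record IsNextTable (t u : ℕ → ℕ) : Set where
    field
      below : ∀ x → u x ≡ select (t x) (t x) (u (n + x))
      end   : ∀ {x} → m * n ≤ x → u x ≡ 0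

  -- The interface between the table and the row scan. A match certifies zeros; conversely a match
  -- is guaranteed at a diagram position whose east neighbour lies in a column already started, that
  -- is, at the end of a run of unstarted columns.
  record IsGuide (u : ℕ → ℕ) : Set where
    field
      match⇒zeros : ∀ {i j} → i < m → j < n → u (i * n + j) ≡ suc (rk i (suc j)) → ∑< (suc j) (a i) ≡ 0
      edge⇒match  : ∀ {i j} → i < m → suc j < n → InDiagram i j → count (suc i) (suc j) ≢ 0 →
                    u (i * n + j) ≡ suc (rk i (suc j))

  module _ {t u : ℕ → ℕ} (isRank : IsRankTable t) (isNext : IsNextTable t u) where
    open IsRankTable isRank
    open IsNextTable isNext

    next-row : ∀ i j → t (i * n + j) ≡ 0 → u (i * n + j) ≡ u (suc i * n + j)
    next-row i j eq = trans (below _) (trans (select-≡0 eq) (cong u (sym (+-assoc n (i * n) j))))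

    next-here : ∀ {x q} → t x ≡ suc q → u x ≡ suc q
    next-here {x} eq = trans (below x) (trans (select-≢0 (λ eq′ → case trans (sym eq) eq′ of λ ())) eq)

    next-source : ∀ d {i j q} → d + i ≡ m → u (i * n + j) ≡ suc q →
                  ∃ λ i′ → i ≤ i′ × i′ < m × t (i′ * n + j) ≡ suc q
    next-source zero    {i} {j} refl eq = case trans (sym eq) (end (m≤m+n (i * n) j)) of λ ()
    next-source (suc d) {i} {j} eqm eq with t (i * n + j) in eqt
    ... | suc q′ = i , ≤-refl , subst (i <_) eqm (s≤s (m≤n+m i d)) , trans eqt (trans (sym (next-here eqt)) eq)
    ... | zero with i′ , i<i′ , i′<m , eq′ ← next-source d (trans (+-suc d i) eqm) (trans (sym (next-row i j eqt)) eq)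
        = i′ , <⇒≤ i<i′ , i′<m , eq′

    -- The table value is the rank of some position `(i′ , j)` with `i ≤ i′`, and that rank counts
    -- row `i` as well. If it does not exceed the count over the rows above `i`, row `i` contributes
    -- nothing.
    next-match⇒zeros : ∀ {i j} → i < m → j < n → u (i * n + j) ≡ suc (rk i (suc j)) → ∑< (suc j) (a i) ≡ 0
    next-match⇒zeros {i} {j} i<m j<n eq
      with i′ , i≤i′ , i′<m , eq′ ← next-source (m ∸ i) (m∸n+n≡m (<⇒≤ i<m)) eq
      = n≤0⇒n≡0 (+-cancelˡ-≤ (rk i (suc j)) _ 0 (begin
          rk i (suc j) + ∑< (suc j) (a i)   ≤⟨ ∑<-monoˡ (λ c → ∑< (suc j) (a c)) (s≤s i≤i′) ⟩
          rk (suc i′) (suc j)               ≡⟨ sound i′<m j<n eq′ ⟨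
          rk i (suc j)                      ≡⟨ +-identityʳ _ ⟨
          rk i (suc j) + 0                  ∎))
      where open ≤-Reasoning

    -- Descend from `(i , j)` inside the diagram until a table entry is met. Each row passed is zero
    -- up to column `j`, so the rank stays the same on the way. The induction is on the number `d`
    -- of rows left.
    edge⇒next-match : ∀ d {i j} → d + i ≡ m → i < m → suc j < n → InDiagram i j → count (suc i) (suc j) ≢ 0 →
                 u (i * n + j) ≡ suc (rk i (suc j))
    edge⇒next-match zero refl i<m _ _ _ = contradiction i<m (<-irrefl refl)
    edge⇒next-match (suc d) {i} {j} eqm i<m sj<n (row0 , col0) started with t (i * n + j) in eqt
    ... | suc q = trans (next-here eqt) (cong suc (trans (sound i<m (<⇒≤ sj<n) eqt) rank-here))
      where
      rank-here : rk (suc i) (suc j) ≡ rk i (suc j)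
      rank-here = trans (cong (rk i (suc j) +_) row0) (+-identityʳ _)
    ... | zero with suc i <? m | inDiagram? (suc i) j
    ... | yes si<m | yes inD = begin
            u (i * n + j)              ≡⟨ next-row i j eqt ⟩
            u (suc i * n + j)          ≡⟨ edge⇒next-match d (trans (+-suc d i) eqm) si<m sj<n inD (started ∘ m+n≡0⇒m≡0 _) ⟩
            suc (rk (suc i) (suc j))   ≡⟨ cong (λ z → suc (rk i (suc j) + z)) row0 ⟩
            suc (rk i (suc j) + 0)     ≡⟨ cong suc (+-identityʳ _) ⟩
            suc (rk i (suc j))         ∎
            where open ≡-Reasoning
    -- In both remaining cases the descent cannot go on: the south neighbour is outside the array or
    -- the diagram. Column `suc j` has a 1 at or above row `i`, which shades the east neighbour. So
    -- `(i , j)` is essential and its entry cannot be 0.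
    ... | no si≮m | _ = case trans (sym eqt) (complete i<m (<⇒≤ sj<n)
            ((row0 , col0) , (λ si<m → contradiction si<m si≮m) , (λ _ → started ∘ proj₂))) of λ ()
    ... | yes _ | no notD = case trans (sym eqt) (complete i<m (<⇒≤ sj<n)
            ((row0 , col0) , (λ _ → notD) , (λ _ → started ∘ proj₂))) of λ ()

    isGuide : IsGuide u
    isGuide = record
      { match⇒zeros = next-match⇒zeros
      ; edge⇒match  = λ {i} i<m → edge⇒next-match (m ∸ i) (m∸n+n≡m (<⇒≤ i<m)) i<m }

  -- Finding the first 1 of a row by a scan.

  -- Otherwise the column has a 1 above row `i` and another at or below it, and convexity puts a 1
  -- into row `i`.
  column-unstarted-or-exhausted : ∀ {i j} → i < m → j < n → a i j ≡ 0 → count i j ≡ 0 ⊎ count i j ≡ σ j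
  column-unstarted-or-exhausted {i} {j} i<m j<n aij≡0 with count i j ≟ 0 | count i j ≟ σ j
  ... | yes eq | _      = inj₁ eq
  ... | no _   | yes eq = inj₂ eq
  ... | no ne  | no ne′
    with c , _ , c<i , above ← ∑<-increase 0 i (λ c → a c j) (n≢0⇒n>0 ne)
    with l , i≤l , l<m , beneath ← ∑<-increase i m (λ c → a c j)
           (≤∧≢⇒< (∑<-monoˡ _ (<⇒≤ i<m)) (λ eq → ne′ (trans eq (colTotal j<n))))
    with m≤n⇒m<n∨m≡n i≤l
  ... | inj₁ i<l  = contradiction aij≡0 (colConvex j<n l<m c<i i<l above beneath)
  ... | inj₂ refl = contradiction aij≡0 beneath

  IsFirst : ℕ → ℕ → Set
  IsFirst i L = L < n × a i L ≢ 0 × ∑< L (a i) ≡ 0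

  -- While columns are scanned from left to right, F is suc of the current
  -- candidate for the first 1 of row i (zero if there is none).  A wrong
  -- candidate survives only through a run of unstarted columns, whose last
  -- column is matched in the guide.
  Candidate : ℕ → ℕ → ℕ → Set
  Candidate i j F = ∀ {L} → IsFirst i L →
    (j ≤ L × (F ≡ 0 ⊎ (j < L × count i j ≡ 0))) ⊎ (L < j × F ≡ suc L)

  -- The match test is outermost because a match refutes every candidate up to and including `j`,
  -- even one that would be proposed at this very step. A positive `σ j ∸ c` means that the column
  -- is not exhausted.
  scanStep : (tᵢⱼ q cᵢⱼ j F : ℕ) → ℕ
  scanStep t q c j F = select (distance t (suc q)) (select F F (select (σ j ∸ c) (suc j) 0)) 0

  module _ {u : ℕ → ℕ} (guide : IsGuide u) where
    open IsGuide guide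

    -- The reason why the true first 1, once proposed, survives the rest of the scan.
    no-match : ∀ {i j L} → i < m → j < n → IsFirst i L → L ≤ j → distance (u (i * n + j)) (suc (rk i (suc j))) ≢ 0
    no-match i<m j<n (_ , one , _) L≤j eq =
      one (∑<≡0⁻ (match⇒zeros i<m j<n (distance≡0⇒≡ eq)) (s≤s L≤j))

    candidate-step : ∀ {i j F} → i < m → j < n → Candidate i j F →
      Candidate i (suc j) (scanStep (u (i * n + j)) (rk i (suc j)) (count i j) j F)
    candidate-step {i} {j} {F} i<m j<n cand {L} first@(L<n , one , before) with cand first
    ... | inj₂ (L<j , refl) = inj₂ (m<n⇒m<1+n L<j , select-≢0 (no-match i<m j<n first (<⇒≤ L<j)))
    ... | inj₁ (j≤L , F-ok) with m≤n⇒m<n∨m≡n j≤L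
    -- The scan reaches `L` without a candidate, since a surviving wrong one would require `j < L`.
    -- Column `L` still has its 1 in row `i` to come, so it is not exhausted and gets proposed.
    ...   | inj₂ refl = inj₂ (≤-refl , trans (select-≢0 (no-match i<m j<n first ≤-refl)) (new F-ok))
      where
      room : σ j ∸ count i j ≢ 0
      room eq = <⇒≱ (begin-strict
        count i j           <⟨ m<m+n (count i j) (n≢0⇒n>0 one) ⟩
        count (suc i) j     ≤⟨ ∑<-monoˡ (λ c → a c j) i<m ⟩
        count m j           ≡⟨ colTotal j<n ⟩
        σ j                 ∎) (m∸n≡0⇒m≤n eq)
        where open ≤-Reasoning
      new : ∀ {F} → F ≡ 0 ⊎ (j < j × count i j ≡ 0) → select F F (select (σ j ∸ count i j) (suc j) 0) ≡ suc j
      new (inj₁ refl)      = select-≢0 room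
      new (inj₂ (j<j , _)) = contradiction j<j (<-irrefl refl)
    ...   | inj₁ j<L = inj₁ (j<L , next)
      where
      row0 : ∑< (suc j) (a i) ≡ 0
      row0 = n≤0⇒n≡0 (subst (∑< (suc j) (a i) ≤_) before (∑<-monoˡ (a i) j<L))
      aij≡0 : a i j ≡ 0
      aij≡0 = ∑<≡0⁻ before j<L
      F′ = scanStep (u (i * n + j)) (rk i (suc j)) (count i j) j F
      -- Column `j` ends a run of unstarted columns: the next one has a 1 above row `i` or, if it is
      -- `L`, in row `i`. The guide then matches and wipes out any wrong candidate.
      matched : count i j ≡ 0 → count (suc i) (suc j) ≢ 0 → F′ ≡ 0
      matched unstarted started = select-≡0 (distance-refl
        (edge⇒match i<m (≤-<-trans j<L L<n) (row0 , cong₂ _+_ unstarted aij≡0) started))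
      next : F′ ≡ 0 ⊎ (suc j < L × count i (suc j) ≡ 0)
      next with count i j ≟ 0
      next | yes unstarted with m≤n⇒m<n∨m≡n j<L | count i (suc j) ≟ 0
      ... | inj₁ sj<L | yes eq = inj₂ (sj<L , eq)
      ... | inj₂ refl | _      = inj₁ (matched unstarted (one ∘ m+n≡0⇒n≡0 (count i (suc j))))
      ... | inj₁ sj<L | no ne  = inj₁ (matched unstarted (ne ∘ m+n≡0⇒m≡0 (count i (suc j))))
      -- Here the column is exhausted. A wrong candidate would have needed it unstarted, so there is
      -- none, and an exhausted column does not propose itself.
      next | no started = inj₁ (idle (column-unstarted-or-exhausted i<m j<n aij≡0) F-ok)
        where
        idle : count i j ≡ 0 ⊎ count i j ≡ σ j → F ≡ 0 ⊎ (j < L × count i j ≡ 0) → F′ ≡ 0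
        idle (inj₁ unstarted) _                      = contradiction unstarted started
        idle (inj₂ _)         (inj₂ (_ , unstarted)) = contradiction unstarted started
        idle (inj₂ exhausted) (inj₁ F≡0)             = trans
          (cong (λ z → select (distance (u (i * n + j)) (suc (rk i (suc j)))) z 0)
                (trans (select-≡0 F≡0) (select-≡0 (trans (cong (σ j ∸_) exhausted) (n∸n≡0 (σ j))))))
          (select-same (distance (u (i * n + j)) (suc (rk i (suc j)))))

  -- Once the first 1 is known, the r i consecutive 1's are written greedily.
  entry-from-candidate : ∀ {i j F} → i < m → j < n → Candidate i n F →
    select (r i ∸ ∑< j (a i)) (select (F ∸ suc j) 0 1) 0 ≡ a i j
  entry-from-candidate {i} {j} {F} i<m j<n cand with a i j ≟ 0
  ... | no one
    with L , s≤s L≤j , oneL , before ← ∑<-least {suc j} (a i) (one ∘ m+n≡0⇒n≡0 (∑< j (a i)))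
    with cand (≤-<-trans L≤j j<n , oneL , before)
  ...   | inj₁ (n≤L , _)  = contradiction (≤-<-trans L≤j j<n) (≤⇒≯ n≤L)
  ...   | inj₂ (_ , refl) = trans (select-≢0 remaining) (trans (select-≡0 (m≤n⇒m∸n≡0 L≤j)) (≤-antisym (n≢0⇒n>0 one) (a≤1 i<m j<n)))
    where
    remaining : r i ∸ ∑< j (a i) ≢ 0
    remaining eq = <⇒≱ (begin-strict
      ∑< j (a i)          <⟨ m<m+n (∑< j (a i)) (n≢0⇒n>0 one) ⟩
      ∑< (suc j) (a i)    ≤⟨ ∑<-monoˡ (a i) j<n ⟩
      ∑< n (a i)          ≡⟨ rowTotal i<m ⟩
      r i                 ∎) (m∸n≡0⇒m≤n eq)
      where open ≤-Reasoning
  entry-from-candidate {i} {j} {F} i<m j<n cand | yes aij≡0 with r i ∸ ∑< j (a i) in eq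
  -- No 1 is left to place. This includes a zero row, about which `Candidate` says nothing.
  ... | zero  = sym aij≡0
  ... | suc _
    with l , j≤l , l<n , onel ← ∑<-increase j n (a i) (subst (∑< j (a i) <_) (sym (rowTotal i<m))
           (m∸n≢0⇒n<m (λ eq′ → case trans (sym eq) eq′ of λ ())))
    with L , L<sl , oneL , before ← ∑<-least {suc l} (a i) (onel ∘ m+n≡0⇒n≡0 (∑< l (a i)))
    with cand (<-≤-trans L<sl l<n , oneL , before)
  ...   | inj₁ (n≤L , _)  = contradiction (<-≤-trans L<sl l<n) (≤⇒≯ n≤L)
  ...   | inj₂ (_ , refl) = trans (select-≢0 (λ eq′ → <⇒≱ j<L (m∸n≡0⇒m≤n eq′))) (sym aij≡0)
    where
    j<L : j < L
    j<L with <-cmp j L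
    ... | tri< lt _ _ = lt
    ... | tri≈ _ refl _ = contradiction aij≡0 oneL
    -- A 1 at `L` left of `j` and one at `l` right of it would force a 1 at `j`.
    ... | tri> _ _ L<j = contradiction aij≡0 (rowConvex i<m l<n L<j
            (≤∧≢⇒< j≤l (λ where refl → onel aij≡0)) oneL onel)

-- Program logic

update-here : {B : Set} (g : ℕ → B) (x : ℕ) {v : B} {y : ℕ} → x ≡ y → update g x v y ≡ v
update-here g x refl with x ≡ᵇ x in eq
... | true  = refl
... | false = ⊥-elim (subst T eq (≡⇒≡ᵇ x x refl))

update-elsewhere : {B : Set} (g : ℕ → B) (x : ℕ) {v : B} {y : ℕ} → x ≢ y → update g x v y ≡ g y
update-elsewhere g x {y = y} x≢y with x ≡ᵇ y in eq
... | true  = contradiction (≡ᵇ⇒≡ x y (subst T (sym eq) _)) x≢y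
... | false = refl

infix 5 _≔_ _[_]≔_ _≔_⇒_∣_

-- Straight-line code, where a conditional only chooses the value assigned. A block therefore acts
-- on states by the function `exec`, and its effect is found by computation.
data Instr : Set where
  _≔_     : ℕ → Expr → Instr
  _[_]≔_  : ℕ → Expr → Expr → Instr
  _≔_⇒_∣_ : ℕ → Expr → Expr → Expr → Instr

instr : Instr → Prog
instr (x ≔ e)         = assign x e
instr (b [ d ]≔ e)    = store b d e
instr (x ≔ c ⇒ d ∣ e) = ifnz c (assign x d) (assign x e)

execInstr : Instr → State → State
execInstr (x ≔ e)         s = setScalar s x (eval s e)
execInstr (b [ d ]≔ e)    s = setArray s b (eval s d) (eval s e)
execInstr (x ≔ c ⇒ d ∣ e) s = setScalar s x (select (eval s c) (eval s d) (eval s e))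

instrCost : Instr → ℕ
instrCost (x ≔ e)         = 1 + cost e
instrCost (b [ d ]≔ e)    = 1 + (cost d + cost e)
-- Both branches are charged, so that the bound does not depend on the state.
instrCost (x ≔ c ⇒ d ∣ e) = 1 + cost c + (1 + (cost d + cost e))

block : List Instr → Prog
block []       = skip
block (i ∷ is) = seq (instr i) (block is)

exec : List Instr → State → State
exec []       s = s
exec (i ∷ is) s = exec is (execInstr i s)

blockCost : List Instr → ℕ
blockCost []       = 1
blockCost (i ∷ is) = instrCost i + blockCost is

Hoare : (State → Set) → Prog → (State → Set) → ℕ → Set
Hoare P p Q c = ∀ {s} → P s → ∃₂ λ s′ t → ⟨ p , s ⟩⇓⟨ s′ , t ⟩ × t ≤ c × Q s′

instr-runs : ∀ i s → ∃ λ t → ⟨ instr i , s ⟩⇓⟨ execInstr i s , t ⟩ × t ≤ instrCost i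
instr-runs (x ≔ e)      s = _ , assign , ≤-refl
instr-runs (b [ d ]≔ e) s = _ , store , ≤-refl
instr-runs (x ≔ c ⇒ d ∣ e) s with eval s c in eq
... | zero  = _ , ifFalse eq assign , +-monoʳ-≤ (1 + cost c) (s≤s (m≤n+m (cost e) (cost d)))
... | suc _ = _ , ifTrue (λ eq′ → case trans (sym eq) eq′ of λ ()) assign , +-monoʳ-≤ (1 + cost c) (s≤s (m≤m+n (cost d) (cost e)))

block-runs : ∀ is s → ∃ λ t → ⟨ block is , s ⟩⇓⟨ exec is s , t ⟩ × t ≤ blockCost is
block-runs []       s = _ , skip , ≤-refl
block-runs (i ∷ is) s
  with _ , run , t≤ ← instr-runs i s
  with _ , runs , u≤ ← block-runs is (execInstr i s)
  = _ , seq run runs , +-mono-≤ t≤ u≤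

hoare-block : ∀ {P Q} is → (∀ s → P s → Q (exec is s)) → Hoare P (block is) Q (blockCost is)
hoare-block is PQ {s} Ps with _ , run , t≤ ← block-runs is s = _ , _ , run , t≤ , PQ s Ps

infixr 4 _⨾_

_⨾_ : ∀ {P Q R p q c d} → Hoare P p Q c → Hoare Q q R d → Hoare P (seq p q) R (c + d)
(h ⨾ k) Ps
  with _ , _ , run , t≤ , Qs ← h Ps
  with _ , _ , run′ , u≤ , Rs ← k Qs
  = _ , _ , seq run run′ , +-mono-≤ t≤ u≤ , Rs

hoare-post : ∀ {P Q Q′ p c} → (∀ {s} → Q s → Q′ s) → Hoare P p Q c → Hoare P p Q′ c
hoare-post QQ′ h Ps with _ , _ , run , t≤ , Qs ← h Ps = _ , _ , run , t≤ , QQ′ Qs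

for : ℕ → ℕ → Prog → Prog
for x y p = seq (assign x (num 0)) (while (var y ⊖ var x) (seq p (assign x (num 1 ⊕ var x))))

-- The 6 is made of the initialisation (2) and the failing last test (4); the 8 of a successful test
-- (4) and the increment (4).
forCost : ℕ → ℕ → ℕ
forCost N c = 6 + N * (8 + c)

-- With at least one round the additive 6 is absorbed into the factor, whence 14 = 6 + 8.
forCost-bound : ∀ {N c} → 0 < N → forCost N c ≤ (14 + c) * N
forCost-bound {suc N} {c} _ = begin
  6 + suc N * (8 + c)           ≤⟨ +-monoˡ-≤ (suc N * (8 + c)) (m≤m*n 6 (suc N)) ⟩
  6 * suc N + suc N * (8 + c)   ≡⟨ cong (6 * suc N +_) (*-comm (suc N) (8 + c)) ⟩
  6 * suc N + (8 + c) * suc N   ≡⟨ *-distribʳ-+ (suc N) 6 (8 + c) ⟨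
  (14 + c) * suc N              ∎
  where open ≤-Reasoning

module _ (x y : ℕ) {p : Prog} {N c : ℕ} (I : ℕ → State → Set)
         (stable : ∀ {k s v} → I k s → I k (setScalar s x v)) (x≢y : x ≢ y)
         (body : ∀ {k} → k < N → Hoare (λ s → scalar s x ≡ k × scalar s y ≡ N × I k s) p
                                       (λ s → scalar s x ≡ k × scalar s y ≡ N × I (suc k) s) c) where

  private
    loop : ∀ d {k} → d + k ≡ N →
      Hoare (λ s → scalar s x ≡ k × scalar s y ≡ N × I k s)
            (while (var y ⊖ var x) (seq p (assign x (num 1 ⊕ var x)))) (I N) (4 + d * (8 + c))
    loop zero refl (xk , yN , inv) = _ , _ , whileFalse (trans (cong₂ _∸_ yN xk) (n∸n≡0 N)) , ≤-refl , inv
    loop (suc d) {k} eq {s} (xk , yN , inv)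
      with s′ , t , run , t≤ , xk′ , yN′ , inv′ ← body (m+n≤o⇒n≤o d (≤-reflexive (trans (+-suc d k) eq))) (xk , yN , inv)
      with s″ , u , run′ , u≤ , inv″ ← loop d (trans (+-suc d k) eq)
             ( trans (update-here (scalar s′) x {y = x} refl) (cong suc xk′)
             , trans (update-elsewhere (scalar s′) x x≢y) yN′ , stable inv′)
      = _ , _ , whileTrue test (seq run assign) run′ , bound , inv″
      where
      test : scalar s y ∸ scalar s x ≢ 0
      test e = <⇒≱ (m+n≤o⇒n≤o d (≤-reflexive (trans (+-suc d k) eq)))
                   (subst₂ _≤_ yN xk (m∸n≡0⇒m≤n e))
      bound : 4 + ((t + 4) + u) ≤ 4 + suc d * (8 + c)
      bound = begin
        4 + ((t + 4) + u)                   ≤⟨ +-monoʳ-≤ 4 (+-mono-≤ (+-monoˡ-≤ 4 t≤) u≤) ⟩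
        4 + ((c + 4) + (4 + d * (8 + c)))   ≡⟨ cong (4 +_) (+-assoc (c + 4) 4 _) ⟨
        4 + (c + 4 + 4 + d * (8 + c))       ≡⟨ cong (λ z → 4 + (z + d * (8 + c))) (trans (+-assoc c 4 4) (+-comm c 8)) ⟩
        4 + (8 + c + d * (8 + c))           ∎
        where open ≤-Reasoning

  -- The invariant takes the counter's value as its index `k` instead of reading it from the state.
  -- For the concrete loops `stable` is then `id`, because the update of the counter reduces away.
  hoare-for : Hoare (λ s → scalar s y ≡ N × I 0 s) (for x y p) (I N) (forCost N c)
  hoare-for {s} (yN , inv)
    with _ , _ , run , t≤ , post ← loop N (+-identityʳ N)
           (update-here (scalar s) x {y = x} refl , trans (update-elsewhere (scalar s) x x≢y) yN , stable inv)
    = _ , _ , seq assign run , +-monoʳ-≤ 2 t≤ , post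

-- Serves injectivity: matrices reconstructed from the same input are read off the same final state.
⇓-deterministic : ∀ {p s s₁ s₂ t₁ t₂} → ⟨ p , s ⟩⇓⟨ s₁ , t₁ ⟩ → ⟨ p , s ⟩⇓⟨ s₂ , t₂ ⟩ → s₁ ≡ s₂
⇓-deterministic skip skip = refl
⇓-deterministic assign assign = refl
⇓-deterministic store store = refl
⇓-deterministic (seq d e) (seq d′ e′) with refl ← ⇓-deterministic d d′ = ⇓-deterministic e e′
⇓-deterministic (ifTrue _ d) (ifTrue _ d′) = ⇓-deterministic d d′
⇓-deterministic (ifTrue ne _) (ifFalse eq _) = contradiction eq ne
⇓-deterministic (ifFalse eq _) (ifTrue ne _) = contradiction eq ne
⇓-deterministic (ifFalse _ d) (ifFalse _ d′) = ⇓-deterministic d d′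
⇓-deterministic (whileTrue _ d e) (whileTrue _ d′ e′) with refl ← ⇓-deterministic d d′ = ⇓-deterministic e e′
⇓-deterministic (whileTrue ne _ _) (whileFalse eq) = contradiction eq ne
⇓-deterministic (whileFalse eq) (whileTrue ne _ _) = contradiction eq ne
⇓-deterministic (whileFalse _) (whileFalse _) = refl

-- The reconstruction program.  Array 6 holds the offsets i * n, array 7 the
-- table of ranks, array 8 the numbers of 1's already placed in each column.

offsetsBody fillBody propagateBody scanStart scanBody writeStart writeBody : List Instr
-- In place of multiplication, scalar 4 accumulates the multiples of `n`. It ends as `m * n`, the
-- bound of the propagation loop.
offsetsBody =
  (6 [ var 3 ]≔ var 4) ∷
  (4 ≔ var 1 ⊕ var 4) ∷ []
fillBody =
  (7 [ arr 6 (arr 2 (var 5)) ⊕ arr 3 (var 5) ]≔ num 1 ⊕ arr 4 (var 5)) ∷ []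
propagateBody =
  (13 ≔ var 4 ⊖ (num 1 ⊕ var 6)) ∷
  -- For a cell of the last row, `var 1 ⊕ var 13` points past the table, where memory is 0.
  (14 ≔ arr 7 (var 13) ⇒ arr 7 (var 13) ∣ arr 7 (var 1 ⊕ var 13)) ∷
  (7 [ var 13 ]≔ var 14) ∷ []
scanStart =
  (8 ≔ num 0) ∷
  (9 ≔ num 0) ∷ []
scanBody =
  -- Scalar 8 becomes `rk i (suc j)`; the other three assignments compute `scanStep` on the
  -- candidate in scalar 9.
  (8 ≔ var 8 ⊕ arr 8 (var 7)) ∷
  (12 ≔ arr 1 (var 7) ⊖ arr 8 (var 7) ⇒ num 1 ⊕ var 7 ∣ num 0) ∷
  (9 ≔ var 9 ⇒ var 9 ∣ var 12) ∷
  (9 ≔ (cell ⊖ (num 1 ⊕ var 8)) ⊕ ((num 1 ⊕ var 8) ⊖ cell) ⇒ var 9 ∣ num 0) ∷ []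
  where
  cell : Expr
  cell = arr 7 (arr 6 (var 6) ⊕ var 7)
writeStart =
  (10 ≔ arr 0 (var 6)) ∷ []
writeBody =
  -- Scalar 9 is `suc` of the column of the first 1, so the difference vanishes from that column on.
  -- Scalar 10, the number of 1's still owed to the row, ends the run.
  (11 ≔ var 9 ⊖ (num 1 ⊕ var 7) ⇒ num 0 ∣ num 1) ∷
  (11 ≔ var 10 ⇒ var 11 ∣ num 0) ∷
  (5 [ arr 6 (var 6) ⊕ var 7 ]≔ var 11) ∷
  (8 [ var 7 ]≔ arr 8 (var 7) ⊕ var 11) ∷
  (10 ≔ var 10 ⊖ var 11) ∷ []

rowProgram program : Prog
rowProgram = seq (block scanStart) (seq (for 7 1 (block scanBody)) (seq (block writeStart) (for 7 1 (block writeBody))))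
program = seq (for 3 0 (block offsetsBody)) (seq (for 5 2 (block fillBody)) (seq (for 6 4 (block propagateBody)) (for 6 0 rowProgram)))

-- The bound on the running time.

rowCost : ℕ → ℕ
rowCost n = blockCost scanStart + (forCost n (blockCost scanBody) + (blockCost writeStart + forCost n (blockCost writeBody)))

programCost : ℕ → ℕ → ℕ → ℕ
programCost m n l =
  forCost m (blockCost offsetsBody) + (forCost l (blockCost fillBody) +
    (forCost (m * n) (blockCost propagateBody) + forCost m (rowCost n)))

rowConstant constant : ℕ
rowConstant = blockCost scanStart + ((14 + blockCost scanBody) + (blockCost writeStart + (14 + blockCost writeBody)))
constant = (14 + blockCost offsetsBody) + ((14 + blockCost fillBody) + ((14 + blockCost propagateBody) + (14 + rowConstant)))

+-*-bound : ∀ {x y} k c d → x ≤ c * k → y ≤ d * k → x + y ≤ (c + d) * k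
+-*-bound k c d x≤ y≤ = ≤-trans (+-mono-≤ x≤ y≤) (≤-reflexive (sym (*-distribʳ-+ k c d)))

forCosts-bound : ∀ {n} c₁ c₂ c₃ c₄ → 0 < n →
  c₁ + (forCost n c₂ + (c₃ + forCost n c₄)) ≤ (c₁ + ((14 + c₂) + (c₃ + (14 + c₄)))) * n
forCosts-bound {n@(suc _)} c₁ c₂ c₃ c₄ 0<n =
  +-*-bound n c₁ ((14 + c₂) + (c₃ + (14 + c₄))) (m≤m*n c₁ n)
    (+-*-bound n (14 + c₂) (c₃ + (14 + c₄)) (forCost-bound {n} {c₂} 0<n)
      (+-*-bound n c₃ (14 + c₄) (m≤m*n c₃ n) (forCost-bound {n} {c₄} 0<n)))

nestedCost-bound : ∀ {m n l} c₁ c₂ c₃ c₄ d → 0 < m → 0 < n → l ≤ m * n → d ≤ c₄ * n →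
  forCost m c₁ + (forCost l c₂ + (forCost (m * n) c₃ + forCost m d)) ≤
  ((14 + c₁) + ((14 + c₂) + ((14 + c₃) + (14 + c₄)))) * (m * n)
nestedCost-bound {m} {n@(suc _)} {l} c₁ c₂ c₃ c₄ d 0<m 0<n l≤mn d≤ =
  +-*-bound (m * n) (14 + c₁) ((14 + c₂) + ((14 + c₃) + (14 + c₄))) (≤-trans (forCost-bound {m} {c₁} 0<m) (*-monoʳ-≤ (14 + c₁) (m≤m*n m n)))
    (+-*-bound (m * n) (14 + c₂) ((14 + c₃) + (14 + c₄))
      -- The list may be empty, so its loop is first compared with one of `m * n` rounds, a positive
      -- number.
      (≤-trans (+-monoʳ-≤ 6 (*-monoˡ-≤ (8 + c₂) l≤mn)) (forCost-bound {m * n} {c₂} 0<mn))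
      (+-*-bound (m * n) (14 + c₃) (14 + c₄) (forCost-bound {m * n} {c₃} 0<mn) rows))
  where
  open ≤-Reasoning
  0<mn : 0 < m * n
  0<mn = *-mono-≤ 0<m 0<n
  rows : forCost m d ≤ (14 + c₄) * (m * n)
  rows = begin
    forCost m d             ≤⟨ forCost-bound {m} {d} 0<m ⟩
    (14 + d) * m            ≤⟨ *-monoˡ-≤ m (+-*-bound n 14 c₄ (m≤m*n 14 n) d≤) ⟩
    (14 + c₄) * n * m       ≡⟨ *-assoc (14 + c₄) n m ⟩
    (14 + c₄) * (n * m)     ≡⟨ cong ((14 + c₄) *_) (*-comm n m) ⟩
    (14 + c₄) * (m * n)     ∎

programCost-bound : ∀ {m n l} → 0 < m → 0 < n → l ≤ m * n → programCost m n l ≤ constant * (m * n)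
programCost-bound {m} {n} {l} 0<m 0<n l≤mn =
  nestedCost-bound {m} {n} {l} (blockCost offsetsBody) (blockCost fillBody) (blockCost propagateBody) rowConstant (rowCost n)
    0<m 0<n l≤mn
    (forCosts-bound {n} (blockCost scanStart) (blockCost scanBody) (blockCost writeStart) (blockCost writeBody) 0<n)

-- Correctness of the program, phase by phase.

cells-toList : ∀ {k} (v : Vector ℕ k) i → cells (toList v) (toℕ i) ≡ v i
cells-toList v fzero    = refl
cells-toList v (fsuc i) = cells-toList (v ∘ fsuc) i

cells-map : {B : Set} (g : B → ℕ) (xs : List B) (p : Fin (length xs)) → cells (List.map g xs) (toℕ p) ≡ g (lookup xs p)
cells-map g (x ∷ xs) fzero    = refl
cells-map g (x ∷ xs) (fsuc p) = cells-map g xs p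

module Correctness {m n : ℕ} (0<n : 0 < n) (X : ConvexArray m n) (L : List (Triple m n)) where
  open ConvexArray X
  open Array X

  row col : Fin (length L) → ℕ
  row p = toℕ (proj₁ (lookup L p))
  col p = toℕ (proj₁ (proj₂ (lookup L p)))

  rankOf : Fin (length L) → ℕ
  rankOf p = proj₂ (proj₂ (lookup L p))

  pos : Fin (length L) → ℕ
  pos p = row p * n + col p

  record IsListing : Set where
    field
      ranks : ∀ p → rankOf p ≡ rk (suc (row p)) (suc (col p))
      total : ∀ {i j} → i < m → j < n → InEssential i j → ∃ λ p → row p ≡ i × col p ≡ j

  Sizes Listed : State → Set
  Sizes s  = scalar s 0 ≡ m × scalar s 1 ≡ n × array s 0 ≡ r × array s 1 ≡ σ
  Listed s = array s 2 ≡ cells (List.map (λ t → toℕ (proj₁ t)) L)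
           × array s 3 ≡ cells (List.map (λ t → toℕ (proj₁ (proj₂ t))) L)
           × array s 4 ≡ cells (List.map (λ t → proj₂ (proj₂ t)) L)

  Offsets : ℕ → (ℕ → ℕ) → Set
  Offsets k g = ∀ {i} → i < k → g i ≡ i * n

  Blank : (ℕ → ℕ) → Set
  Blank g = ∀ x → g x ≡ 0

  offsets-step : ∀ {k g} → Offsets k g → Offsets (suc k) (update g k (k * n))
  offsets-step {k} {g} offs {i} i<sk with k ≟ i
  ... | yes refl = update-here g k refl
  ... | no k≢i   = trans (update-elsewhere g k k≢i) (offs (≤∧≢⇒< (s≤s⁻¹ i<sk) (k≢i ∘ sym)))

  OffsetsInv : ℕ → State → Set
  OffsetsInv k s = Sizes s × scalar s 2 ≡ length L × Listed s × Blank (array s 7) × Blank (array s 8)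
                 × scalar s 4 ≡ k * n × Offsets k (array s 6)

  offsets-correct : Hoare (λ s → scalar s 0 ≡ m × OffsetsInv 0 s) (for 3 0 (block offsetsBody)) (OffsetsInv m)
                          (forCost m (blockCost offsetsBody))
  offsets-correct = hoare-for 3 0 OffsetsInv id (λ ()) (λ k<m → hoare-block offsetsBody (step k<m))
    where
    step : ∀ {k} → k < m → ∀ s → scalar s 3 ≡ k × scalar s 0 ≡ m × OffsetsInv k s →
      let s′ = exec offsetsBody s in scalar s′ 3 ≡ k × scalar s′ 0 ≡ m × OffsetsInv (suc k) s′
    step _ s (refl , m≡ , sizes@(_ , n≡ , _) , len , listed , blank₇ , blank₈ , acc , offs) =
      refl , m≡ , sizes , len , listed , blank₇ , blank₈ , cong₂ _+_ n≡ acc ,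
      subst (λ v → Offsets (suc (scalar s 3)) (update (array s 6) (scalar s 3) v)) (sym acc) (offsets-step offs)

  Filled : ℕ → (ℕ → ℕ) → Set
  Filled k t = (∀ {x q} → t x ≡ suc q → ∃ λ p → x ≡ pos p × q ≡ rankOf p)
             × (∀ p → toℕ p < k → t (pos p) ≡ suc (rankOf p))

  FillInv : ℕ → State → Set
  FillInv k s = Sizes s × Listed s × Blank (array s 8) × scalar s 4 ≡ m * n × Offsets m (array s 6) × Filled k (array s 7)

  -- Positions are treated from the last one upwards; k of them are done.
  Propagated : (t : ℕ → ℕ) → ℕ → (ℕ → ℕ) → Set
  Propagated t k u = (∀ {x} → x + k < m * n → u x ≡ t x)
                   × (∀ {x} → m * n ≤ x + k → u x ≡ select (t x) (t x) (u (n + x)))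
                   × (∀ {x} → m * n ≤ x → u x ≡ 0)

  -- The sweep works in place. At its turn the cell `q` still holds `t q`, while `n + q` lies beyond
  -- it because `0 < n`, hence is already final.
  propagated-step : ∀ {t k u q} → q + suc k ≡ m * n → Propagated t k u →
    Propagated t (suc k) (update u q (select (u q) (u q) (u (n + q))))
  propagated-step {t} {k} {u} {q} eq (untouched , done , end) = untouched′ , done′ , end′
    where
    u′ = update u q (select (u q) (u q) (u (n + q)))
    later : ∀ {x} → q < x → u′ x ≡ u x
    later q<x = update-elsewhere u q (<⇒≢ q<x)
    below : ∀ {x} → q ≤ x → u′ (n + x) ≡ u (n + x)
    below {x} q≤x = later (≤-<-trans q≤x (m<n+m x 0<n))
    q+k<mn : q + k < m * n
    q+k<mn = ≤-reflexive (trans (sym (+-suc q k)) eq)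
    untouched′ : ∀ {x} → x + suc k < m * n → u′ x ≡ t x
    untouched′ {x} lt = trans (update-elsewhere u q (λ q≡x → <⇒≢ lt (trans (cong (_+ suc k) (sym q≡x)) eq)))
                              (untouched (<-trans (+-monoʳ-< x (n<1+n k)) lt))
    done′ : ∀ {x} → m * n ≤ x + suc k → u′ x ≡ select (t x) (t x) (u′ (n + x))
    done′ {x} le with q ≟ x
    ... | yes refl = trans (update-here u q refl) (cong₂ (λ z w → select z z w) (untouched q+k<mn) (sym (below ≤-refl)))
    ... | no q≢x   = trans (later q<x) (trans (done (subst (_≤ x + k) eq (subst (_≤ x + k) (sym (+-suc q k)) (+-monoˡ-≤ k q<x))))
                                         (cong (select (t x) (t x)) (sym (below (<⇒≤ q<x)))))
      where
      q<x : q < x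
      q<x = ≤∧≢⇒< (+-cancelʳ-≤ (suc k) q x (subst (_≤ x + suc k) (sym eq) le)) q≢x
    end′ : ∀ {x} → m * n ≤ x → u′ x ≡ 0
    end′ le = trans (later (<-≤-trans (≤-<-trans (m≤m+n q k) q+k<mn) le)) (end le)

  -- The original table survives only as the ghost value `t`, since array 7 is overwritten.
  PropagateInv : ℕ → State → Set
  PropagateInv k s = Sizes s × Blank (array s 8) × Offsets m (array s 6)
                   × ∃ λ t → IsRankTable t × Propagated t k (array s 7)

  propagate-correct : Hoare (λ s → scalar s 4 ≡ m * n × PropagateInv 0 s) (for 6 4 (block propagateBody)) (PropagateInv (m * n))
                            (forCost (m * n) (blockCost propagateBody))
  propagate-correct = hoare-for 6 4 PropagateInv id (λ ()) (λ k<mn → hoare-block propagateBody (step k<mn))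
    where
    step : ∀ {k} → k < m * n → ∀ s → scalar s 6 ≡ k × scalar s 4 ≡ m * n × PropagateInv k s →
      let s′ = exec propagateBody s in scalar s′ 6 ≡ k × scalar s′ 4 ≡ m * n × PropagateInv (suc k) s′
    step k<mn s (refl , mn≡ , sizes@(_ , n≡ , _) , blank , offs , t , isRank , prop) =
      refl , mn≡ , sizes , blank , offs , t , isRank ,
      subst₂ (λ z q → Propagated t (suc (scalar s 6)) (update (array s 7) q (select (array s 7 q) (array s 7 q) (array s 7 (z + q)))))
             (sym n≡) (cong (_∸ suc (scalar s 6)) (sym mn≡)) (propagated-step (m∸n+n≡m k<mn) prop)

  Ready : State → Set
  Ready s = Sizes s × Offsets m (array s 6) × IsGuide (array s 7)

  Written : ℕ → (ℕ → ℕ) → Set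
  Written K g = ∀ {i j} → j < n → i * n + j < K → g (i * n + j) ≡ a i j

  written-step : ∀ {i j g} → j < n → Written (i * n + j) g → Written (suc (i * n + j)) (update g (i * n + j) (a i j))
  written-step {i} {j} {g} j<n written {i′} {j′} j′<n lt with i * n + j ≟ i′ * n + j′
  ... | no ne  = trans (update-elsewhere g _ ne) (written j′<n (≤∧≢⇒< (s≤s⁻¹ lt) (ne ∘ sym)))
  ... | yes eq with refl , refl ← position-unique i i′ j<n j′<n eq = update-here g _ refl

  -- Within a row, array 8 is a mixture: the columns already written include row `i`, the others do
  -- not.
  Counted : ℕ → ℕ → (ℕ → ℕ) → Set
  Counted i j g = (∀ {b} → b < j → g b ≡ count (suc i) b) × (∀ {b} → j ≤ b → b < n → g b ≡ count i b)

  counted-step : ∀ {i j g v} → v ≡ count (suc i) j → Counted i j g → Counted i (suc j) (update g j v)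
  counted-step {i} {j} {g} {v} eq (before , after) = before′ , λ j<b b<n → trans (update-elsewhere g j (<⇒≢ j<b)) (after (<⇒≤ j<b) b<n)
    where
    before′ : ∀ {b} → b < suc j → update g j v b ≡ count (suc i) b
    before′ {b} b<sj with j ≟ b
    ... | yes refl = trans (update-here g j refl) eq
    ... | no j≢b   = trans (update-elsewhere g j j≢b) (before (≤∧≢⇒< (s≤s⁻¹ b<sj) (j≢b ∘ sym)))

  RowInv : ℕ → State → Set
  RowInv i s = Ready s × (∀ {j} → j < n → array s 8 j ≡ count i j) × Written (i * n) (array s 5)

  ScanInv WriteInv : ℕ → ℕ → State → Set
  ScanInv i j s  = scalar s 6 ≡ i × RowInv i s × scalar s 8 ≡ rk i j × Candidate i j (scalar s 9)
  WriteInv i j s = scalar s 6 ≡ i × Ready s × Counted i j (array s 8) × Written (i * n + j) (array s 5)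
                 × scalar s 10 ≡ r i ∸ ∑< j (a i) × Candidate i n (scalar s 9)

  module _ {i : ℕ} (i<m : i < m) where

    scan-correct : Hoare (λ s → scalar s 1 ≡ n × ScanInv i 0 s) (for 7 1 (block scanBody)) (ScanInv i n)
                         (forCost n (blockCost scanBody))
    scan-correct = hoare-for 7 1 (ScanInv i) id (λ ()) (λ j<n → hoare-block scanBody (step i<m j<n))
      where
      step : ∀ {i j} → i < m → j < n → ∀ s → scalar s 7 ≡ j × scalar s 1 ≡ n × ScanInv i j s →
        let s′ = exec scanBody s in scalar s′ 7 ≡ j × scalar s′ 1 ≡ n × ScanInv i (suc j) s′
      step {i} {j} i<m j<n s (refl , n≡ , refl , rowInv@(((_ , _ , _ , σ≡) , offs , guide) , counted , _) , acc , cand) =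
        refl , n≡ , refl , rowInv , acc′ ,
        subst₂ Candidate′ (sym acc′) (sym (offs i<m))
          (subst₂ (λ c σⱼ → Candidate i (suc j) (select (distance (u (i * n + j)) (suc (rk i (suc j))))
                      (select F F (select (σⱼ ∸ c) (suc j) 0)) 0))
             (sym (counted j<n)) (sym (cong (λ g → g j) σ≡))
             (candidate-step guide i<m j<n cand))
        where
        u = array s 7
        F = scalar s 9
        -- The stored column count lets the rank move one column east by a single addition, so a
        -- cell takes constant time.
        acc′ : scalar s 8 + array s 8 j ≡ rk i (suc j)
        acc′ = trans (cong₂ _+_ acc (counted j<n)) (sym (rk-sucʳ i j))
        Candidate′ : ℕ → ℕ → Set
        Candidate′ q o = Candidate i (suc j) (select (distance (u (o + j)) (suc q))
                           (select F F (select (array s 1 j ∸ array s 8 j) (suc j) 0)) 0)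

    write-correct : Hoare (λ s → scalar s 1 ≡ n × WriteInv i 0 s) (for 7 1 (block writeBody)) (WriteInv i n)
                          (forCost n (blockCost writeBody))
    write-correct = hoare-for 7 1 (WriteInv i) id (λ ()) (λ j<n → hoare-block writeBody (step i<m j<n))
      where
      step : ∀ {i j} → i < m → j < n → ∀ s → scalar s 7 ≡ j × scalar s 1 ≡ n × WriteInv i j s →
        let s′ = exec writeBody s in scalar s′ 7 ≡ j × scalar s′ 1 ≡ n × WriteInv i (suc j) s′
      step {i} {j} i<m j<n s (refl , n≡ , refl , ready@(_ , offs , _) , counted , written , left , cand) =
        refl , n≡ , refl , ready ,
        counted-step (cong₂ _+_ (proj₂ counted ≤-refl j<n) v≡) counted ,
        subst (λ K → Written K (array (exec writeBody s) 5)) (sym (+-suc (i * n) j))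
          (subst₂ (λ o w → Written (suc (i * n + j)) (update (array s 5) (o + j) w)) (sym (offs i<m)) (sym v≡)
            (written-step {i} {g = array s 5} j<n written)) ,
        trans (cong₂ _∸_ left v≡) (∸-+-assoc (r i) (∑< j (a i)) (a i j)) ,
        cand
        where
        v≡ : select (scalar s 10) (select (scalar s 9 ∸ suc j) 0 1) 0 ≡ a i j
        v≡ = trans (cong (λ z → select z (select (scalar s 9 ∸ suc j) 0 1) 0) left) (entry-from-candidate i<m j<n cand)

    row-correct : Hoare (λ s → scalar s 6 ≡ i × scalar s 0 ≡ m × RowInv i s) rowProgram
                        (λ s → scalar s 6 ≡ i × scalar s 0 ≡ m × RowInv (suc i) s) (rowCost n)
    row-correct =
      hoare-block {P = λ s → scalar s 6 ≡ i × scalar s 0 ≡ m × RowInv i s} {Q = λ s → scalar s 1 ≡ n × ScanInv i 0 s} scanStart (λ s → λ where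
        (i≡ , _ , rowInv@(((_ , n≡ , _) , _) , _)) →
          n≡ , i≡ , rowInv , sym (∑<-zero i) , λ {_} _ → inj₁ (z≤n , inj₁ refl)) ⨾
      scan-correct ⨾
      hoare-block {P = ScanInv i n} {Q = λ s → scalar s 1 ≡ n × WriteInv i 0 s} writeStart (λ s → λ where
        (i≡ , (ready@((_ , n≡ , r≡ , _) , _) , counted , written) , _ , cand) →
          n≡ , i≡ , ready , ((λ {_} ()) , λ {b} _ → counted {b}) ,
          subst (λ K → Written K (array s 5)) (sym (+-identityʳ (i * n))) written ,
          cong₂ (λ g k → g k) r≡ i≡ , cand) ⨾
      hoare-post (λ {s} → λ where
        (i≡ , ready@((m≡ , _) , _) , counted , written , _) →
          i≡ , m≡ , ready , (λ {b} → proj₁ counted {b}) , λ {c} {b} → subst (λ K → Written K (array s 5)) (+-comm (i * n) n) written {c} {b})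
        write-correct

  module _ (listing : IsListing) where
    open IsListing listing

    col< : ∀ p → col p < n
    col< p = toℕ<n (proj₁ (proj₂ (lookup L p)))

    row< : ∀ p → row p < m
    row< p = toℕ<n (proj₁ (lookup L p))

    rank-at : ∀ p i {j} → j < n → pos p ≡ i * n + j → rankOf p ≡ rk (suc i) (suc j)
    rank-at p i j<n eq with row≡ , col≡ ← position-unique (row p) i (col< p) j<n eq =
      trans (ranks p) (cong₂ (λ c b → rk (suc c) (suc b)) row≡ col≡)

    filled-step : ∀ p {t} → Filled (toℕ p) t → Filled (suc (toℕ p)) (update t (pos p) (suc (rankOf p)))
    filled-step p {t} (sound , complete) = sound′ , complete′
      where
      t′ = update t (pos p) (suc (rankOf p))
      sound′ : ∀ {x q} → t′ x ≡ suc q → ∃ λ p′ → x ≡ pos p′ × q ≡ rankOf p′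
      sound′ {x} eq with pos p ≟ x
      ... | yes refl = p , refl , suc-injective (trans (sym eq) (update-here t (pos p) refl))
      ... | no ne    = sound (trans (sym (update-elsewhere t (pos p) ne)) eq)
      complete′ : ∀ p′ → toℕ p′ < suc (toℕ p) → t′ (pos p′) ≡ suc (rankOf p′)
      complete′ p′ lt with pos p ≟ pos p′
      -- Two triples at the same position carry the rank of the same cell, so overwriting changes
      -- nothing.
      ... | yes eq = trans (update-here t (pos p) eq) (cong suc (trans (rank-at p (row p′) (col< p′) eq) (sym (ranks p′))))
      ... | no ne  = trans (update-elsewhere t (pos p) ne)
                           (complete p′ (≤∧≢⇒< (s≤s⁻¹ lt) (λ eq → ne (cong pos (sym (toℕ-injective eq))))))

    filled⇒isRankTable : ∀ {t} → Filled (length L) t → IsRankTable t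
    filled⇒isRankTable {t} (sound , complete) = record
      { sound    = λ {i} i<m j<n eq → case sound eq of λ where
                     (p , pos≡ , refl) → rank-at p i j<n (sym pos≡)
      ; complete = λ i<m j<n ess → case total i<m j<n ess of λ where
                     (p , refl , refl) → trans (complete p (toℕ<n p)) (cong suc (ranks p))
      ; outside  = outside }
      where
      outside : ∀ {x} → m * n ≤ x → t x ≡ 0
      outside {x} le with t x in eq
      ... | zero  = refl
      ... | suc _ with p , refl , _ ← sound eq = contradiction le (<⇒≱ (position-bound (row< p) (col< p)))

    fill-correct : Hoare (λ s → scalar s 2 ≡ length L × FillInv 0 s) (for 5 2 (block fillBody)) (FillInv (length L))
                         (forCost (length L) (blockCost fillBody))
    fill-correct = hoare-for 5 2 FillInv id (λ ()) (λ k<l → hoare-block fillBody (step k<l))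
      where
      at : ∀ p s → scalar s 5 ≡ toℕ p × scalar s 2 ≡ length L × FillInv (toℕ p) s →
        let s′ = exec fillBody s in scalar s′ 5 ≡ toℕ p × scalar s′ 2 ≡ length L × FillInv (suc (toℕ p)) s′
      at p s (k≡ , len , sizes , listed@(rows≡ , cols≡ , ranks≡) , blank , mn≡ , offs , filled) =
        k≡ , len , sizes , listed , blank , mn≡ , offs ,
        subst₂ (λ x v → Filled (suc (toℕ p)) (update (array s 7) x (suc v)))
          (sym (cong₂ _+_ (trans (cong (array s 6) (read rows≡)) (offs (row< p))) (read cols≡)))
          (sym (read ranks≡)) (filled-step p filled)
        where
        read : ∀ {b} {g : Triple m n → ℕ} → array s b ≡ cells (List.map g L) → array s b (scalar s 5) ≡ g (lookup L p)
        read {g = g} eq = trans (cong₂ (λ h k → h k) eq k≡) (cells-map g L p)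
      step : ∀ {k} → k < length L → ∀ s → scalar s 5 ≡ k × scalar s 2 ≡ length L × FillInv k s →
        let s′ = exec fillBody s in scalar s′ 5 ≡ k × scalar s′ 2 ≡ length L × FillInv (suc k) s′
      step k<l = subst (λ k → ∀ s → scalar s 5 ≡ k × scalar s 2 ≡ length L × FillInv k s →
        let s′ = exec fillBody s in scalar s′ 5 ≡ k × scalar s′ 2 ≡ length L × FillInv (suc k) s′)
        (toℕ-fromℕ< k<l) (at (fromℕ< k<l))

    program-correct : Hoare (OffsetsInv 0) program (λ s → Written (m * n) (array s 5)) (programCost m n (length L))
    program-correct pre@(sizes , _) = (offsets ⨾ fill ⨾ propagate ⨾ rows) (proj₁ sizes , pre)
      where
      offsets = hoare-post
        {Q′ = λ s → scalar s 2 ≡ length L × FillInv 0 s}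
        (λ where
          (sizes , len , listed , blank₇ , blank₈ , mn≡ , offs) →
            len , sizes , listed , blank₈ , mn≡ , offs ,
            (λ {x} eq → case trans (sym eq) (blank₇ x) of λ ()) , λ _ ())
        offsets-correct
      fill = hoare-post
        {Q′ = λ s → scalar s 4 ≡ m * n × PropagateInv 0 s}
        (λ {s} → λ where
          (sizes , _ , blank , mn≡ , offs , filled) →
            let isRank = filled⇒isRankTable filled
                open IsRankTable isRank in
            mn≡ , sizes , blank , offs , array s 7 , isRank ,
            (λ _ → refl) ,
            -- Before the sweep only positions past the table count as done, and there both sides
            -- are 0.
            (λ {x} le → let mn≤x = subst (m * n ≤_) (+-identityʳ x) le in
               trans (outside mn≤x) (sym (trans (select-≡0 (outside mn≤x)) (outside (≤-trans mn≤x (m≤n+m x n)))))) ,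
            outside)
        fill-correct
      propagate = hoare-post
        {Q′ = λ s → scalar s 0 ≡ m × RowInv 0 s}
        (λ where
          (sizes , blank , offs , t , isRank , _ , done , end) →
            proj₁ sizes ,
            (sizes , offs , isGuide isRank (record { below = λ x → done (m≤n+m (m * n) x) ; end = end })) ,
            (λ {j} _ → blank j) , λ _ ())
        propagate-correct
      rows = hoare-post
        {Q′ = λ s → Written (m * n) (array s 5)}
        (λ {s} rowInv → λ {i} {j} → proj₂ (proj₂ rowInv) {i} {j})
        (hoare-for 6 0 RowInv id (λ ()) row-correct)

-- Extension of a matrix by zeros to an array indexed by ℕ

entry : ∀ {m n} → Matrix01 m n → ℕ → ℕ → ℕ
entry A i j = cells (toList (λ i′ → cells (toList (λ j′ → toℕ (A i′ j′))) j)) i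

entry-toℕ : ∀ {m n} (A : Matrix01 m n) i j → entry A (toℕ i) (toℕ j) ≡ toℕ (A i j)
entry-toℕ A i j = trans (cells-toList _ i) (cells-toList _ j)

entry-fromℕ< : ∀ {m n} (A : Matrix01 m n) {i j} (i<m : i < m) (j<n : j < n) →
               entry A i j ≡ toℕ (A (fromℕ< i<m) (fromℕ< j<n))
entry-fromℕ< A i<m j<n =
  trans (cong₂ (entry A) (sym (toℕ-fromℕ< i<m)) (sym (toℕ-fromℕ< j<n))) (entry-toℕ A _ _)

toℕ≢0⇒1F : ∀ {x : Fin 2} → toℕ x ≢ 0 → x ≡ 1F
toℕ≢0⇒1F {0F} ne = contradiction refl ne
toℕ≢0⇒1F {1F} _  = refl

1F⇒toℕ≢0 : ∀ {x : Fin 2} → x ≡ 1F → toℕ x ≢ 0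
1F⇒toℕ≢0 refl ()

fromℕ<-mono-< : ∀ {n i j} (i<n : i < n) (j<n : j < n) → i < j → fromℕ< i<n Fin.< fromℕ< j<n
fromℕ<-mono-< i<n j<n = subst₂ _<_ (sym (toℕ-fromℕ< i<n)) (sym (toℕ-fromℕ< j<n))

onFin : ∀ {k} (P : ℕ → Set) → (∀ (i : Fin k) → P (toℕ i)) → ∀ {i} → i < k → P i
onFin P h i<k = subst P (toℕ-fromℕ< i<k) (h (fromℕ< i<k))

-- Matrices of `𝒞 R S` as convex arrays, and their essential positions.

module _ {m n : ℕ} {R : Vector ℕ m} {S : Vector ℕ n} where

  convexArray : 𝒞 R S → ConvexArray m n
  convexArray A = record
    { a         = entry M
    ; r         = cells (toList R)
    ; σ         = cells (toList S)
    ; a≤1       = λ i<m j<n → subst (_≤ 1) (sym (entry-fromℕ< M i<m j<n)) (s≤s⁻¹ (toℕ<n (M (fromℕ< i<m) (fromℕ< j<n))))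
    ; rowConvex = λ i<m l<n j<k k<l aij ail →
        let k<n = <-trans k<l l<n; j<n = <-trans j<k k<n in
        nonzero i<m k<n (Convex.rows (convex A) (fromℕ< i<m) (fromℕ<-mono-< j<n k<n j<k) (fromℕ<-mono-< k<n l<n k<l)
          (one i<m j<n aij) (one i<m l<n ail))
    ; colConvex = λ j<n l<m i<k k<l aij alj →
        let k<m = <-trans k<l l<m; i<m = <-trans i<k k<m in
        nonzero k<m j<n (Convex.cols (convex A) (fromℕ< j<n) (fromℕ<-mono-< i<m k<m i<k) (fromℕ<-mono-< k<m l<m k<l)
          (one i<m j<n aij) (one l<m j<n alj))
    ; rowTotal  = onFin (λ i → ∑< n (entry M i) ≡ cells (toList R) i) (λ i →
        trans (sym (sum-∑< n (λ j → sym (entry-toℕ M i j)))) (trans (rowSums A i) (sym (cells-toList R i))))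
    ; colTotal  = onFin (λ j → ∑< m (λ i → entry M i j) ≡ cells (toList S) j) (λ j →
        trans (sym (sum-∑< m (λ i → sym (entry-toℕ M i j)))) (trans (colSums A j) (sym (cells-toList S j))))
    }
    where
    M = matrix A
    one : ∀ {i j} (i<m : i < m) (j<n : j < n) → entry M i j ≢ 0 → M (fromℕ< i<m) (fromℕ< j<n) ≡ 1F
    one i<m j<n ne = toℕ≢0⇒1F (ne ∘ trans (entry-fromℕ< M i<m j<n))
    nonzero : ∀ {i j} (i<m : i < m) (j<n : j < n) → M (fromℕ< i<m) (fromℕ< j<n) ≡ 1F → entry M i j ≢ 0
    nonzero i<m j<n eq = 1F⇒toℕ≢0 eq ∘ trans (sym (entry-fromℕ< M i<m j<n))

  module _ (A : 𝒞 R S) where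
    private M = matrix A
    open Array (convexArray A)

    rank≡rk : ∀ i j → rank M i j ≡ rk (suc (toℕ i)) (suc (toℕ j))
    rank≡rk i j = sum-∑< (suc (toℕ i)) λ c → sum-∑< (suc (toℕ j)) λ b →
      trans (sym (entry-toℕ M _ _)) (cong₂ (entry M) (toℕ-inject≤ c (toℕ<n i)) (toℕ-inject≤ b (toℕ<n j)))

    inDiagram⇒diagram : ∀ {i j} → InDiagram (toℕ i) (toℕ j) → Diagram M i j
    inDiagram⇒diagram (row0 , _) (c , b , eq , inj₁ (refl , b≤j)) =
      1F⇒toℕ≢0 eq (trans (sym (entry-toℕ M c b)) (∑<≡0⁻ row0 (s≤s b≤j)))
    inDiagram⇒diagram (_ , col0) (c , b , eq , inj₂ (refl , c≤i)) =
      1F⇒toℕ≢0 eq (trans (sym (entry-toℕ M c b)) (∑<≡0⁻ {g = λ i → entry M i (toℕ b)} col0 (s≤s c≤i)))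

    -- Membership in the diagram is a negation, but an entry is decidably 0, so excluding every
    -- shading 1 yields vanishing sums.
    diagram⇒inDiagram : ∀ {i j} → Diagram M i j → InDiagram (toℕ i) (toℕ j)
    diagram⇒inDiagram {i} {j} unshaded = ∑<≡0⁺ row0 , ∑<≡0⁺ col0
      where
      row0 : ∀ {b} → b < suc (toℕ j) → entry M (toℕ i) b ≡ 0
      row0 {b} b<sj = onFin (λ b → b ≤ toℕ j → entry M (toℕ i) b ≡ 0) (λ b b≤j →
        case entry M (toℕ i) (toℕ b) ≟ 0 of λ where
          (yes eq) → eq
          (no ne)  → contradiction (i , b , toℕ≢0⇒1F (ne ∘ trans (entry-toℕ M i b)) , inj₁ (refl , b≤j)) unshaded)
        (<-≤-trans b<sj (toℕ<n j)) (s≤s⁻¹ b<sj)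
      col0 : ∀ {c} → c < suc (toℕ i) → entry M c (toℕ j) ≡ 0
      col0 {c} c<si = onFin (λ c → c ≤ toℕ i → entry M c (toℕ j) ≡ 0) (λ c c≤i →
        case entry M (toℕ c) (toℕ j) ≟ 0 of λ where
          (yes eq) → eq
          (no ne)  → contradiction (c , j , toℕ≢0⇒1F (ne ∘ trans (entry-toℕ M c j)) , inj₂ (refl , c≤i)) unshaded)
        (<-≤-trans c<si (toℕ<n i)) (s≤s⁻¹ c<si)

    inEssential⇒essential : ∀ {i j} → InEssential (toℕ i) (toℕ j) → Essential M i j
    inEssential⇒essential {i} {j} (inD , south , east) = record
      { inDiagram = inDiagram⇒diagram inD
      ; south     = λ i′ eq D → south (subst (_< m) eq (toℕ<n i′)) (subst (λ z → InDiagram z (toℕ j)) eq (diagram⇒inDiagram D))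
      ; east      = λ j′ eq D → east (subst (_< n) eq (toℕ<n j′)) (subst (InDiagram (toℕ i)) eq (diagram⇒inDiagram D))
      }

    diagram? : ∀ i j → Dec (Diagram M i j)
    diagram? i j = map′ inDiagram⇒diagram diagram⇒inDiagram (inDiagram? (toℕ i) (toℕ j))

    essential? : ∀ i j → Dec (Essential M i j)
    essential? i j = map′
      (λ (D , south , east) → record { inDiagram = D ; south = south ; east = east })
      (λ ess → let open Essential ess in inDiagram , south , east)
      (diagram? i j
        ×-dec all? (λ i′ → (toℕ i′ ≟ suc (toℕ i)) →-dec ¬? (diagram? i′ j))
        ×-dec all? (λ j′ → (toℕ j′ ≟ suc (toℕ j)) →-dec ¬? (diagram? i j′)))

    ranked : Fin m × Fin n → Triple m n
    ranked (i , j) = i , j , rank M i j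

    -- Injectivity is drawn from runs of the program, whose input is a list; this one supplies it.
    essentialList : List (Triple m n)
    essentialList = List.map ranked (filter (λ (i , j) → essential? i j) (cartesianProduct (allFin m) (allFin n)))

    essentialList-enumerates : Enumerates essentialList (f A)
    essentialList-enumerates =
      map⁺ (cong λ (i , j , _) → i , j) (filter⁺ _ (cartesianProduct⁺ (allFin⁺ m) (allFin⁺ n))) ,
      λ (i , j , _) → mk⇔
        (λ t∈ → case ∈-map∘filter⁻ ranked (λ (i , j) → essential? i j) {xs = cartesianProduct (allFin m) (allFin n)} t∈ of λ where
          (_ , _ , refl , ess) → ess , refl)
        (λ where
          (ess , refl) → ∈-map∘filter⁺ ranked (λ (i , j) → essential? i j)
            ((i , j) , ∈-cartesianProduct⁺ (∈-allFin i) (∈-allFin j) , refl , ess))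

-- The program run on a listing of the ranked essential set.

lookup-injective : {B : Set} {xs : List B} → Unique xs → ∀ p q → lookup xs p ≡ lookup xs q → p ≡ q
lookup-injective (_ ∷ _)  fzero    fzero    _  = refl
lookup-injective (x∉ ∷ _) fzero    (fsuc q) eq = contradiction eq (All.lookup x∉ (∈-lookup q))
lookup-injective (x∉ ∷ _) (fsuc p) fzero    eq = contradiction (sym eq) (All.lookup x∉ (∈-lookup p))
lookup-injective (_ ∷ u)  (fsuc p) (fsuc q) eq = cong fsuc (lookup-injective u p q eq)

module _ {m n : ℕ} {R : Vector ℕ m} {S : Vector ℕ n} (A : 𝒞 R S)
         (L : List (Triple m n)) (enum : Enumerates L (f A)) where

  listed-ranked : ∀ p → f A (lookup L p)
  listed-ranked p = Equivalence.to (proj₂ enum (lookup L p)) (∈-lookup p)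

  -- The rank is determined by the position, so distinct triples occupy distinct cells. This keeps
  -- the loop over the list within the time bound.
  listed-length : length L ≤ m * n
  listed-length = injective⇒≤ {f = cell} cell-injective
    where
    cell : Fin (length L) → Fin (m * n)
    cell p = combine (proj₁ (lookup L p)) (proj₁ (proj₂ (lookup L p)))
    cell-injective : ∀ {p q} → cell p ≡ cell q → p ≡ q
    cell-injective {p} {q} eq
      with i≡ , j≡ ← combine-injective _ _ (proj₁ (lookup L q)) (proj₁ (proj₂ (lookup L q))) eq
      = lookup-injective (proj₁ enum) p q (cong₂ _,_ i≡ (cong₂ _,_ j≡
          (trans (proj₂ (listed-ranked p)) (trans (cong₂ (rank (matrix A)) i≡ j≡) (sym (proj₂ (listed-ranked q)))))))

  module _ (0<n : 0 < n) where
    open Array (convexArray A)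
    open Correctness 0<n (convexArray A) L

    isListing : IsListing
    isListing = record
      { ranks = λ p → trans (proj₂ (listed-ranked p)) (rank≡rk A _ _)
      ; total = total }
      where
      total : ∀ {i j} → i < m → j < n → InEssential i j → ∃ λ p → row p ≡ i × col p ≡ j
      total {i} {j} i<m j<n ess = index t∈ ,
        trans (cong (λ t → toℕ (proj₁ t)) (sym (lookup-index t∈))) (toℕ-fromℕ< i<m) ,
        trans (cong (λ t → toℕ (proj₁ (proj₂ t))) (sym (lookup-index t∈))) (toℕ-fromℕ< j<n)
        where
        t∈ : ranked A (fromℕ< i<m , fromℕ< j<n) ∈ L
        t∈ = Equivalence.from (proj₂ enum _)
          (inEssential⇒essential A (subst₂ InEssential (sym (toℕ-fromℕ< i<m)) (sym (toℕ-fromℕ< j<n)) ess) , refl)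

    program-reconstructs : 0 < m →
      ∃₂ λ s t → ⟨ program , input R S L ⟩⇓⟨ s , t ⟩ × t ≤ constant * (m * n) × Outputs s (matrix A)
    program-reconstructs 0<m =
      let s , t , run , t≤ , written = program-correct isListing {s = input R S L}
            ((refl , refl , refl , refl) , refl , (refl , refl , refl) , (λ _ → refl) , (λ _ → refl) , refl , λ ())
      in  s , t , run , ≤-trans t≤ (programCost-bound 0<m 0<n listed-length) ,
          λ i j → trans (written (toℕ<n j) (position-bound (toℕ<n i) (toℕ<n j))) (entry-toℕ (matrix A) i j)

-- Injectivity and the final statement.

outputs-unique : ∀ {m n p s c d} {A B : Matrix01 m n} →
  (∃₂ λ s′ t → ⟨ p , s ⟩⇓⟨ s′ , t ⟩ × t ≤ c × Outputs s′ A) →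
  (∃₂ λ s′ t → ⟨ p , s ⟩⇓⟨ s′ , t ⟩ × t ≤ d × Outputs s′ B) → ∀ i j → A i j ≡ B i j
outputs-unique (_ , _ , runA , _ , outA) (_ , _ , runB , _ , outB) i j
  with refl ← ⇓-deterministic runA runB = toℕ-injective (trans (sym (outA i j)) (outB i j))

f-injective : ∀ {m n} → 0 < m → 0 < n → (R : Vector ℕ m) (S : Vector ℕ n) → Injective (_≈_ {R = R} {S = S}) _≐_ f
f-injective {m} {n} 0<m 0<n R S {A} {B} (A⊆B , B⊆A) = outputs-unique {p = program} {c = constant * (m * n)} {d = constant * (m * n)}
  (program-reconstructs A L enumA 0<n 0<m) (program-reconstructs B L enumB 0<n 0<m)
  where
  -- The listing made for `A` also enumerates `f B`, so both reconstructions start from the same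
  -- state.
  L = essentialList A
  enumA : Enumerates L (f A)
  enumA = essentialList-enumerates A
  enumB : Enumerates L (f B)
  enumB = proj₁ enumA , λ t → let open Equivalence (proj₂ enumA t) in mk⇔ (A⊆B ∘ to) (from ∘ B⊆A)

mainTheorem1 : (∀ (m n : ℕ) → 0 < m → 0 < n → (R : Vector ℕ m) (S : Vector ℕ n) → sum R ≡ sum S →
    Injective (_≈_ {R = R} {S = S}) _≐_ f)
    ×
    (∃₂ λ (p : Prog) (c : ℕ) →
    ∀ (m n : ℕ) → 0 < m → 0 < n → (R : Vector ℕ m) (S : Vector ℕ n) → sum R ≡ sum S →
    (A : 𝒞 R S) → Reconstructs p c A)
mainTheorem1 =
  (λ m n 0<m 0<n R S _ {A} {B} → f-injective 0<m 0<n R S {A} {B}) ,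
  program , constant , λ m n 0<m 0<n R S _ A L enum → program-reconstructs A L enum 0<n 0<m
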